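{- Let $(t_j^i)_{0\le j\le i}$ be real numbers and let $h_{j,k}^i$ ($0\le k\le i$, $0\le j\le i-k$) be defined by $h_{j,0}^i=t_j^i$ and $h_{j,k}^i=h_{j,k-1}^{i-1}+h_{j,k-1}^{i}+h_{j+1,k-1}^{i}$ for $k\ge 1$. Define the tetrahedron coefficient transform $b_n=\sum_{i=0}^{n}\sum_{j=0}^{i}\binom{n}{j,\,n-i,\,i-j}t_j^i$. Then $h_{0,n}^n=b_n$ for every $n\ge 0$.
   Context: For non-negative integers $p,q,r$ with $p+q+r=n$, $\binom{n}{p,q,r}=\frac{n!}{p!\,q!\,r!}$ denotes the tetrahedron trinomial coefficient. -}

module Defs where

open import Algebra.Bundles using (CommutativeRing)
open import Algebra.Structures using (IsCommutativeRing)
open import Data.Fin.Base using (toℕ)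
open import Data.Fin.Properties using (toℕ≤pred[n])
open import Data.Integer.Base using (+_)
open import Data.Nat.Base as ℕ using (ℕ; zero; suc; _∸_; _!)
open import Data.Nat.Combinatorics using (k![n∸k]!∣n!)
open import Data.Nat.Divisibility using (_∣_; ∣-trans; *-monoˡ-∣)
import Data.Nat.DivMod as ℕ
import Data.Nat.Properties as ℕ
open import Data.Product.Base using (∃-syntax; _×_; _,_)
open import Data.Rational.Base as ℚ using (ℚ; 0ℚ; 1ℚ; ½; ∣_∣; 1/_; Positive)
import Data.Rational.Properties as ℚ
open import Data.Rational.Solver using (module +-*-Solver)
open import Level using (0ℓ)
open import Relation.Binary.PropositionalEquality using (_≡_; refl; sym; trans; cong; subst; module ≡-Reasoning)

-- Real numbers: Cauchy sequences of rationals, with the setoid equality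
-- "the difference tends to 0".

Cauchy : (ℕ → ℚ) → Set
Cauchy x = ∀ ε → 0ℚ ℚ.< ε → ∃[ N ] (∀ m n → N ℕ.≤ m → N ℕ.≤ n → ∣ x m ℚ.- x n ∣ ℚ.< ε)

record ℝ : Set where
  constructor mkℝ
  field
    seq    : ℕ → ℚ
    cauchy : Cauchy seq

open ℝ public

infix 4 _≃_

_≃_ : ℝ → ℝ → Set
x ≃ y = ∀ ε → 0ℚ ℚ.< ε → ∃[ N ] (∀ n → N ℕ.≤ n → ∣ seq x n ℚ.- seq y n ∣ ℚ.< ε)

private
  half-pos : ∀ ε → 0ℚ ℚ.< ε → 0ℚ ℚ.< ½ ℚ.* ε
  half-pos ε 0<ε =
    subst (ℚ._< ½ ℚ.* ε) (ℚ.*-zeroʳ ½) (ℚ.*-monoʳ-<-pos ½ 0<ε)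

  half+half : ∀ ε → ½ ℚ.* ε ℚ.+ ½ ℚ.* ε ≡ ε
  half+half ε = trans (sym (ℚ.*-distribʳ-+ ε ½ ½)) (ℚ.*-identityˡ ε)

  ∣x-x∣<ε : ∀ x {y} ε → x ≡ y → 0ℚ ℚ.< ε → ∣ x ℚ.- y ∣ ℚ.< ε
  ∣x-x∣<ε x ε refl 0<ε = subst (ℚ._< ε) (sym (cong ∣_∣ (ℚ.+-inverseʳ x))) 0<ε

  dist-sym : ∀ x y → ∣ x ℚ.- y ∣ ≡ ∣ y ℚ.- x ∣
  dist-sym x y = trans (sym (ℚ.∣-p∣≡∣p∣ (x ℚ.- y)))
    (cong ∣_∣ (solve 2 (λ a b → :- (a :- b) := b :- a) refl x y))
    where open +-*-Solver

  ∣sum∣< : ∀ ε x y → ∣ x ∣ ℚ.< ½ ℚ.* ε → ∣ y ∣ ℚ.< ½ ℚ.* ε → ∣ x ℚ.+ y ∣ ℚ.< ε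
  ∣sum∣< ε x y p q = ℚ.≤-<-trans (ℚ.∣p+q∣≤∣p∣+∣q∣ x y)
    (subst (∣ x ∣ ℚ.+ ∣ y ∣ ℚ.<_) (half+half ε) (ℚ.+-mono-< p q))

  dist-trans : ∀ ε x y z → ∣ x ℚ.- y ∣ ℚ.< ½ ℚ.* ε → ∣ y ℚ.- z ∣ ℚ.< ½ ℚ.* ε → ∣ x ℚ.- z ∣ ℚ.< ε
  dist-trans ε x y z p q = subst (λ w → ∣ w ∣ ℚ.< ε)
    (solve 3 (λ a b c → (a :- b) :+ (b :- c) := a :- c) refl x y z)
    (∣sum∣< ε (x ℚ.- y) (y ℚ.- z) p q)
    where open +-*-Solver

  dist-+ : ∀ ε a b c d → ∣ a ℚ.- c ∣ ℚ.< ½ ℚ.* ε → ∣ b ℚ.- d ∣ ℚ.< ½ ℚ.* ε →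
           ∣ (a ℚ.+ b) ℚ.- (c ℚ.+ d) ∣ ℚ.< ε
  dist-+ ε a b c d p q = subst (λ w → ∣ w ∣ ℚ.< ε)
    (solve 4 (λ a b c d → (a :- c) :+ (b :- d) := (a :+ b) :- (c :+ d)) refl a b c d)
    (∣sum∣< ε (a ℚ.- c) (b ℚ.- d) p q)
    where open +-*-Solver

  dist-neg : ∀ ε a b → ∣ a ℚ.- b ∣ ℚ.< ε → ∣ ℚ.- a ℚ.- ℚ.- b ∣ ℚ.< ε
  dist-neg ε a b p = subst (ℚ._< ε)
    (trans (dist-sym a b)
      (cong ∣_∣ (solve 2 (λ a b → b :- a := (:- a) :- (:- b)) refl a b))) p
    where open +-*-Solver

  shrink : ∀ B .{{_ : Positive B}} → ℚ → ℚ
  shrink B ε = (1/ B) {{ℚ.pos⇒nonZero B}} ℚ.* (½ ℚ.* ε)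

  shrink-pos : ∀ B .{{_ : Positive B}} ε → 0ℚ ℚ.< ε → 0ℚ ℚ.< shrink B ε
  shrink-pos B ε 0<ε = subst (ℚ._< shrink B ε) (ℚ.*-zeroʳ r)
    (ℚ.*-monoʳ-<-pos r {{ℚ.1/pos⇒pos B}} (half-pos ε 0<ε))
    where r = (1/ B) {{ℚ.pos⇒nonZero B}}

  ∣product∣< : ∀ B .{{_ : Positive B}} ε x y → ∣ x ∣ ℚ.≤ B → ∣ y ∣ ℚ.< shrink B ε →
               ∣ x ℚ.* y ∣ ℚ.< ½ ℚ.* ε
  ∣product∣< B ε x y p q = begin-strict
    ∣ x ℚ.* y ∣                ≡⟨ ℚ.∣p*q∣≡∣p∣*∣q∣ x y ⟩
    ∣ x ∣ ℚ.* ∣ y ∣            ≤⟨ ℚ.*-monoʳ-≤-nonNeg ∣ y ∣ {{ℚ.∣-∣-nonNeg y}} p ⟩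
    B ℚ.* ∣ y ∣                <⟨ ℚ.*-monoʳ-<-pos B q ⟩
    B ℚ.* (r ℚ.* (½ ℚ.* ε))    ≡⟨ sym (ℚ.*-assoc B r (½ ℚ.* ε)) ⟩
    (B ℚ.* r) ℚ.* (½ ℚ.* ε)    ≡⟨ cong (ℚ._* (½ ℚ.* ε)) (ℚ.*-inverseʳ B {{ℚ.pos⇒nonZero B}}) ⟩
    1ℚ ℚ.* (½ ℚ.* ε)           ≡⟨ ℚ.*-identityˡ (½ ℚ.* ε) ⟩
    ½ ℚ.* ε                    ∎
    where
    open ℚ.≤-Reasoning
    r = (1/ B) {{ℚ.pos⇒nonZero B}}

  dist-* : ∀ B .{{_ : Positive B}} ε a b c d → ∣ a ∣ ℚ.≤ B → ∣ d ∣ ℚ.≤ B →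
           ∣ a ℚ.- c ∣ ℚ.< shrink B ε → ∣ b ℚ.- d ∣ ℚ.< shrink B ε →
           ∣ a ℚ.* b ℚ.- c ℚ.* d ∣ ℚ.< ε
  dist-* B ε a b c d a≤B d≤B p q = subst (λ w → ∣ w ∣ ℚ.< ε)
    (solve 4 (λ a b c d → a :* (b :- d) :+ d :* (a :- c) := a :* b :- c :* d) refl a b c d)
    (∣sum∣< ε (a ℚ.* (b ℚ.- d)) (d ℚ.* (a ℚ.- c))
      (∣product∣< B ε a (b ℚ.- d) a≤B q) (∣product∣< B ε d (a ℚ.- c) d≤B p))
    where open +-*-Solver

  0<1 : 0ℚ ℚ.< 1ℚ
  0<1 = ℚ.positive⁻¹ 1ℚ

  ∣x∣≤ : ∀ x y → ∣ x ℚ.- y ∣ ℚ.< 1ℚ → ∣ x ∣ ℚ.≤ 1ℚ ℚ.+ ∣ y ∣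
  ∣x∣≤ x y p = begin
    ∣ x ∣                      ≡⟨ cong ∣_∣ (solve 2 (λ a b → a := (a :- b) :+ b) refl x y) ⟩
    ∣ (x ℚ.- y) ℚ.+ y ∣        ≤⟨ ℚ.∣p+q∣≤∣p∣+∣q∣ (x ℚ.- y) y ⟩
    ∣ x ℚ.- y ∣ ℚ.+ ∣ y ∣      ≤⟨ ℚ.+-monoˡ-≤ ∣ y ∣ (ℚ.<⇒≤ p) ⟩
    1ℚ ℚ.+ ∣ y ∣               ∎
    where
    open ℚ.≤-Reasoning
    open +-*-Solver

  bounded : ∀ x y → ∃[ B ] (Positive B × ∃[ N ] (∀ n → N ℕ.≤ n → (∣ seq x n ∣ ℚ.≤ B) × (∣ seq y n ∣ ℚ.≤ B)))
  bounded x y with cauchy x 1ℚ 0<1 | cauchy y 1ℚ 0<1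
  ... | M , f | N , g =
    X ℚ.+ Y , ℚ.pos+pos⇒pos X Y , M ℕ.⊔ N , λ n le →
      (ℚ.≤-trans (∣x∣≤ (seq x n) (seq x M) (f n M (ℕ.m⊔n≤o⇒m≤o M N le) ℕ.≤-refl))
        (subst (ℚ._≤ X ℚ.+ Y) (ℚ.+-identityʳ X) (ℚ.+-monoʳ-≤ X (ℚ.<⇒≤ (ℚ.positive⁻¹ Y))))) ,
      (ℚ.≤-trans (∣x∣≤ (seq y n) (seq y N) (g n N (ℕ.m⊔n≤o⇒n≤o M N le) ℕ.≤-refl))
        (subst (ℚ._≤ X ℚ.+ Y) (ℚ.+-identityˡ Y) (ℚ.+-monoˡ-≤ Y (ℚ.<⇒≤ (ℚ.positive⁻¹ X)))))
    where
    X = 1ℚ ℚ.+ ∣ seq x M ∣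
    Y = 1ℚ ℚ.+ ∣ seq y N ∣
    instance
      X-pos : Positive X
      X-pos = ℚ.pos+nonNeg⇒pos 1ℚ ∣ seq x M ∣ {{ℚ.∣-∣-nonNeg (seq x M)}}
      Y-pos : Positive Y
      Y-pos = ℚ.pos+nonNeg⇒pos 1ℚ ∣ seq y N ∣ {{ℚ.∣-∣-nonNeg (seq y N)}}

infixl 6 _+_
infixl 7 _*_
infix  8 -_

fromℚ : ℚ → ℝ
fromℚ q = mkℝ (λ _ → q) (λ ε 0<ε → 0 , λ _ _ _ _ → ∣x-x∣<ε q ε refl 0<ε)

fromℕ : ℕ → ℝ
fromℕ n = fromℚ (+ n ℚ./ 1)

0ℝ 1ℝ : ℝ
0ℝ = fromℚ 0ℚ
1ℝ = fromℚ 1ℚ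

_+_ : ℝ → ℝ → ℝ
x + y = mkℝ (λ n → seq x n ℚ.+ seq y n) c
  where
  c : Cauchy (λ n → seq x n ℚ.+ seq y n)
  c ε 0<ε =
    let (M , f) = cauchy x (½ ℚ.* ε) (half-pos ε 0<ε)
        (N , g) = cauchy y (½ ℚ.* ε) (half-pos ε 0<ε)
    in M ℕ.⊔ N , λ m n p q →
    dist-+ ε (seq x m) (seq y m) (seq x n) (seq y n)
      (f m n (ℕ.m⊔n≤o⇒m≤o M N p) (ℕ.m⊔n≤o⇒m≤o M N q))
      (g m n (ℕ.m⊔n≤o⇒n≤o M N p) (ℕ.m⊔n≤o⇒n≤o M N q))

-_ : ℝ → ℝ
- x = mkℝ (λ n → ℚ.- seq x n) c
  where
  c : Cauchy (λ n → ℚ.- seq x n)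
  c ε 0<ε =
    let (N , f) = cauchy x ε 0<ε
    in N , λ m n p q → dist-neg ε (seq x m) (seq x n) (f m n p q)

_*_ : ℝ → ℝ → ℝ
x * y = mkℝ (λ n → seq x n ℚ.* seq y n) c
  where
  c : Cauchy (λ n → seq x n ℚ.* seq y n)
  c ε 0<ε =
    let (B , B-pos , K , bd) = bounded x y
        (M , f) = cauchy x (shrink B {{B-pos}} ε) (shrink-pos B {{B-pos}} ε 0<ε)
        (N , g) = cauchy y (shrink B {{B-pos}} ε) (shrink-pos B {{B-pos}} ε 0<ε)
    in K ℕ.⊔ (M ℕ.⊔ N) , λ m n p q →
    let p′ = ℕ.m⊔n≤o⇒n≤o K (M ℕ.⊔ N) p
        q′ = ℕ.m⊔n≤o⇒n≤o K (M ℕ.⊔ N) q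
        (xm≤B , _) = bd m (ℕ.m⊔n≤o⇒m≤o K (M ℕ.⊔ N) p)
        (_ , yn≤B) = bd n (ℕ.m⊔n≤o⇒m≤o K (M ℕ.⊔ N) q)
    in dist-* B {{B-pos}} ε (seq x m) (seq y m) (seq x n) (seq y n) xm≤B yn≤B
      (f m n (ℕ.m⊔n≤o⇒m≤o M N p′) (ℕ.m⊔n≤o⇒m≤o M N q′))
      (g m n (ℕ.m⊔n≤o⇒n≤o M N p′) (ℕ.m⊔n≤o⇒n≤o M N q′))

≃-pointwise : ∀ x y → (∀ n → seq x n ≡ seq y n) → x ≃ y
≃-pointwise x y e ε 0<ε = 0 , λ n _ → ∣x-x∣<ε (seq x n) ε (e n) 0<ε

≃-refl : ∀ {x} → x ≃ x
≃-refl {x} = ≃-pointwise x x (λ _ → refl)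

≃-sym : ∀ {x y} → x ≃ y → y ≃ x
≃-sym {x} {y} e ε 0<ε =
  let (N , f) = e ε 0<ε
  in N , λ n p → subst (ℚ._< ε) (dist-sym (seq x n) (seq y n)) (f n p)

≃-trans : ∀ {x y z} → x ≃ y → y ≃ z → x ≃ z
≃-trans {x} {y} {z} d e ε 0<ε =
  let (M , f) = d (½ ℚ.* ε) (half-pos ε 0<ε)
      (N , g) = e (½ ℚ.* ε) (half-pos ε 0<ε)
  in M ℕ.⊔ N , λ n p →
  dist-trans ε (seq x n) (seq y n) (seq z n) (f n (ℕ.m⊔n≤o⇒m≤o M N p)) (g n (ℕ.m⊔n≤o⇒n≤o M N p))

+-cong : ∀ {x y u v} → x ≃ y → u ≃ v → x + u ≃ y + v
+-cong {x} {y} {u} {v} d e ε 0<ε =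
  let (M , f) = d (½ ℚ.* ε) (half-pos ε 0<ε)
      (N , g) = e (½ ℚ.* ε) (half-pos ε 0<ε)
  in M ℕ.⊔ N , λ n p →
  dist-+ ε (seq x n) (seq u n) (seq y n) (seq v n) (f n (ℕ.m⊔n≤o⇒m≤o M N p)) (g n (ℕ.m⊔n≤o⇒n≤o M N p))

-‿cong : ∀ {x y} → x ≃ y → - x ≃ - y
-‿cong {x} {y} d ε 0<ε =
  let (N , f) = d ε 0<ε
  in N , λ n p → dist-neg ε (seq x n) (seq y n) (f n p)

*-cong : ∀ {x y u v} → x ≃ y → u ≃ v → x * u ≃ y * v
*-cong {x} {y} {u} {v} d e ε 0<ε =
  let (B , B-pos , K , bd) = bounded x v
      (M , f) = d (shrink B {{B-pos}} ε) (shrink-pos B {{B-pos}} ε 0<ε)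
      (N , g) = e (shrink B {{B-pos}} ε) (shrink-pos B {{B-pos}} ε 0<ε)
  in K ℕ.⊔ (M ℕ.⊔ N) , λ n p →
  let p′ = ℕ.m⊔n≤o⇒n≤o K (M ℕ.⊔ N) p
      (xn≤B , vn≤B) = bd n (ℕ.m⊔n≤o⇒m≤o K (M ℕ.⊔ N) p)
  in dist-* B {{B-pos}} ε (seq x n) (seq u n) (seq y n) (seq v n) xn≤B vn≤B
    (f n (ℕ.m⊔n≤o⇒m≤o M N p′)) (g n (ℕ.m⊔n≤o⇒n≤o M N p′))

ℝ-isCommutativeRing : IsCommutativeRing _≃_ _+_ _*_ -_ 0ℝ 1ℝ
ℝ-isCommutativeRing = record
  { isRing = record
    { +-isAbelianGroup = record
      { isGroup = record
        { isMonoid = record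
          { isSemigroup = record
            { isMagma = record
              { isEquivalence = record
                { refl  = λ {x} → ≃-refl {x}
                ; sym   = λ {x} {y} → ≃-sym {x} {y}
                ; trans = λ {x} {y} {z} → ≃-trans {x} {y} {z}
                }
              ; ∙-cong = λ {x} {y} {u} {v} → +-cong {x} {y} {u} {v}
              }
            ; assoc = λ x y z → ≃-pointwise ((x + y) + z) (x + (y + z))
                (λ n → ℚ.+-assoc (seq x n) (seq y n) (seq z n))
            }
          ; identity =
              (λ x → ≃-pointwise (0ℝ + x) x (λ n → ℚ.+-identityˡ (seq x n))) ,
              (λ x → ≃-pointwise (x + 0ℝ) x (λ n → ℚ.+-identityʳ (seq x n)))
          }
        ; inverse =
            (λ x → ≃-pointwise (- x + x) 0ℝ (λ n → ℚ.+-inverseˡ (seq x n))) ,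
            (λ x → ≃-pointwise (x + - x) 0ℝ (λ n → ℚ.+-inverseʳ (seq x n)))
        ; ⁻¹-cong = λ {x} {y} → -‿cong {x} {y}
        }
      ; comm = λ x y → ≃-pointwise (x + y) (y + x) (λ n → ℚ.+-comm (seq x n) (seq y n))
      }
    ; *-cong = λ {x} {y} {u} {v} → *-cong {x} {y} {u} {v}
    ; *-assoc = λ x y z → ≃-pointwise ((x * y) * z) (x * (y * z))
        (λ n → ℚ.*-assoc (seq x n) (seq y n) (seq z n))
    ; *-identity =
        (λ x → ≃-pointwise (1ℝ * x) x (λ n → ℚ.*-identityˡ (seq x n))) ,
        (λ x → ≃-pointwise (x * 1ℝ) x (λ n → ℚ.*-identityʳ (seq x n)))
    ; distrib =
        (λ x y z → ≃-pointwise (x * (y + z)) (x * y + x * z)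
          (λ n → ℚ.*-distribˡ-+ (seq x n) (seq y n) (seq z n))) ,
        (λ x y z → ≃-pointwise ((y + z) * x) (y * x + z * x)
          (λ n → ℚ.*-distribʳ-+ (seq x n) (seq y n) (seq z n)))
    }
  ; *-comm = λ x y → ≃-pointwise (x * y) (y * x) (λ n → ℚ.*-comm (seq x n) (seq y n))
  }

ℝ-commutativeRing : CommutativeRing 0ℓ 0ℓ
ℝ-commutativeRing = record { isCommutativeRing = ℝ-isCommutativeRing }

open import Algebra.Properties.Monoid.Sum (CommutativeRing.+-monoid ℝ-commutativeRing) using (sum⁺-syntax)

private
  p!q!r!≢0 : ∀ p q r → ℕ.NonZero (p ! ℕ.* q ! ℕ.* r !)
  p!q!r!≢0 p q r = ℕ.m*n≢0 _ _ {{p ℕ.!* q !≢0}} {{r ℕ.!≢0}}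

-- The natural-number quotient is exact, see trinomial-exact.
trinomial : (n p q r : ℕ) → .(p ℕ.+ q ℕ.+ r ≡ n) → ℕ
trinomial n p q r _ = (n ! ℕ./ (p ! ℕ.* q ! ℕ.* r !)) {{p!q!r!≢0 p q r}}

private
  m!n!∣[m+n]! : ∀ m n → m ! ℕ.* n ! ∣ (m ℕ.+ n) !
  m!n!∣[m+n]! m n =
    subst (λ k → m ! ℕ.* k ! ∣ (m ℕ.+ n) !) (ℕ.m+n∸m≡n m n) (k![n∸k]!∣n! (ℕ.m≤m+n m n))

trinomial-exact : ∀ n p q r (e : p ℕ.+ q ℕ.+ r ≡ n) →
                  trinomial n p q r e ℕ.* (p ! ℕ.* q ! ℕ.* r !) ≡ n !
trinomial-exact n p q r refl = ℕ.m/n*n≡m {{p!q!r!≢0 p q r}}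
  (∣-trans (*-monoˡ-∣ (r !) (m!n!∣[m+n]! p q)) (m!n!∣[m+n]! (p ℕ.+ q) r))

-- A family (t^i_j) indexed by 0 ≤ j ≤ i only; t i j is t^i_j.
Triangle : Set
Triangle = (i j : ℕ) → .(j ℕ.≤ i) → ℝ

-- h t i j k is h^i_{j,k}.  The domain 0 ≤ k ≤ i, 0 ≤ j ≤ i - k is the single
-- condition k + j ≤ i, so no values are assigned outside it.
h : Triangle → (i j k : ℕ) → .(k ℕ.+ j ℕ.≤ i) → ℝ
h t i       j zero    j≤i = t i j j≤i
h t (suc i) j (suc k) le  =
  h t i j k (ℕ.s≤s⁻¹ le) +
  h t (suc i) j k (ℕ.<⇒≤ le) +
  h t (suc i) (suc j) k (subst (ℕ._≤ suc i) (sym (ℕ.+-suc k j)) le)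

private
  indices-sum : ∀ {n i j} → i ℕ.≤ n → j ℕ.≤ i → j ℕ.+ (n ∸ i) ℕ.+ (i ∸ j) ≡ n
  indices-sum {n} {i} {j} i≤n j≤i = begin
    j ℕ.+ (n ∸ i) ℕ.+ (i ∸ j)    ≡⟨ ℕ.+-assoc j (n ∸ i) (i ∸ j) ⟩
    j ℕ.+ ((n ∸ i) ℕ.+ (i ∸ j))  ≡⟨ cong (j ℕ.+_) (ℕ.+-comm (n ∸ i) (i ∸ j)) ⟩
    j ℕ.+ ((i ∸ j) ℕ.+ (n ∸ i))  ≡⟨ sym (ℕ.+-assoc j (i ∸ j) (n ∸ i)) ⟩
    j ℕ.+ (i ∸ j) ℕ.+ (n ∸ i)    ≡⟨ cong (ℕ._+ (n ∸ i)) (ℕ.m+[n∸m]≡n j≤i) ⟩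
    i ℕ.+ (n ∸ i)                ≡⟨ ℕ.m+[n∸m]≡n i≤n ⟩
    n                            ∎
    where open ≡-Reasoning

-- The bound variables of the sums range over Fin (suc n) and Fin (suc i).
b : Triangle → ℕ → ℝ
b t n =
  ∑[ i′ ≤ n ] ∑[ j′ ≤ toℕ i′ ]
    (let i = toℕ i′
         j = toℕ j′
     in fromℕ (trinomial n j (n ∸ i) (i ∸ j) (indices-sum (toℕ≤pred[n] i′) (toℕ≤pred[n] j′)))
        * t i j (toℕ≤pred[n] j′))

{-# OPTIONS --safe #-}

-- The trinomial coefficient factors as C(n,i) C(i,j), so b_n is an iterated
-- binomial transform.  By Pascal's rule the binomial transform satisfies
-- β_{n+1}(x) = β_n(x) + β_n(x ∘ suc); applied to the outer and then to the inner
-- transform it yields the three-term recurrence of h, and induction on k gives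
-- h^i_{j,k} = Σ_{a ≤ k} C(k,a) Σ_{c ≤ a} C(a,c) t^{i-(k-a)}_{j+c}.
module Submission where

open import Defs
open import Data.Nat.Base using (ℕ)
open import Data.Nat.Properties using (≤-reflexive; +-identityʳ)

open import Algebra.Bundles using (CommutativeMonoid; CommutativeRing)
open import Data.Fin.Base as Fin using (Fin; toℕ)
open import Data.Fin.Patterns using (0F; 1F)
open import Data.Fin.Properties using (toℕ≤pred[n]; toℕ-inject₁; toℕ-fromℕ)
open import Data.Integer.Base as ℤ using (+_)
import Data.Integer.Properties as ℤ
open import Data.Nat.Base as ℕ using (zero; suc; _∸_; _≤_; _!)
open import Data.Nat.Combinatorics using (_C_; nCk≡n!/k![n-k]!; k>n⇒nCk≡0; k![n∸k]!∣n!; nCk+nC[k+1]≡[n+1]C[k+1])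
open import Data.Nat.Coprimality as Coprime using (1-coprimeTo)
import Data.Nat.DivMod as ℕ
import Data.Nat.Properties as ℕ
open import Data.Nat.Solver using (module +-*-Solver)
open import Data.Rational.Base as ℚ using (mkℚ; 1ℚ)
import Data.Rational.Properties as ℚ
open import Function.Base using (_∘_)
open import Relation.Binary.PropositionalEquality as ≡ using (_≡_; cong; cong₂)
open import Relation.Nullary.Decidable.Core using (yes; no; recompute)
open import Relation.Nullary.Negation.Core using (contradiction-irr)

-- Natural number coefficients act by repeated addition `×`, so the combinatorics lives in any
-- commutative monoid; it is applied below to the additive monoid of the reals.
module BinomialTransform {c ℓ} (M : CommutativeMonoid c ℓ) where

  open CommutativeMonoid M
  open import Algebra.Properties.CommutativeMonoid.Mult M
  open import Algebra.Properties.CommutativeMonoid.Sum M hiding (sum)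
  open import Algebra.Properties.CommutativeMonoid.Sum M using (sum) public
  open import Relation.Binary.Reasoning.Setoid setoid

  ×-distrib-sum : ∀ m {n} (f : Fin n → Carrier) → m × sum f ≈ ∑[ i < n ] (m × f i)
  ×-distrib-sum m {zero}  f = ×-zeroʳ m
    where
    ×-zeroʳ : ∀ m → m × ε ≈ ε
    ×-zeroʳ zero    = refl
    ×-zeroʳ (suc m) = trans (∙-congˡ (×-zeroʳ m)) (identityʳ ε)
  ×-distrib-sum m {suc n} f =
    trans (×-distrib-+ (f Fin.zero) (sum (f ∘ Fin.suc)) m) (∙-congˡ (×-distrib-sum m (f ∘ Fin.suc)))

  triangle-sum : ∀ n → (∀ (i : Fin (suc n)) → Fin (suc (toℕ i)) → Carrier) → Carrier
  triangle-sum n x = sum (λ i → sum (x i))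

  binomial : ℕ → (ℕ → Carrier) → Carrier
  binomial n x = ∑[ i ≤ n ] ((n C toℕ i) × x (toℕ i))

  binomial-cong : ∀ n {x y : ℕ → Carrier} → (∀ i → i ≤ n → x i ≈ y i) → binomial n x ≈ binomial n y
  binomial-cong n x≈y = sum-cong-≋ {suc n} λ i → ×-congʳ (n C toℕ i) (x≈y (toℕ i) (toℕ≤pred[n] i))

  binomial-∙ : ∀ n (x y : ℕ → Carrier) → binomial n (λ i → x i ∙ y i) ≈ binomial n x ∙ binomial n y
  binomial-∙ n x y = trans
    (sum-cong-≋ {suc n} λ i → ×-distrib-+ (x (toℕ i)) (y (toℕ i)) (n C toℕ i))
    (∑-distrib-+ {suc n} (λ i → (n C toℕ i) × x (toℕ i)) (λ i → (n C toℕ i) × y (toℕ i)))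

  sum-toℕ-last : ∀ n (g : ℕ → Carrier) → ∑[ i ≤ n ] g (toℕ i) ≈ ∑[ i < n ] g (toℕ i) ∙ g n
  sum-toℕ-last n g = trans (sum-init-last (g ∘ toℕ)) (reflexive
    (cong₂ _∙_ (sum-cong-≗ {n} λ i → cong g (toℕ-inject₁ i)) (cong g (toℕ-fromℕ n))))

  -- Pascal's rule splits each coefficient `suc n C suc i`. The `n C i` parts form the transform of
  -- `x ∘ suc`; the `n C suc i` parts and the index 0 term form the sum of `w` up to `suc n`, whose
  -- top term vanishes because `n C suc n` is 0.
  binomial-suc : ∀ n x → binomial (suc n) x ≈ binomial n x ∙ binomial n (x ∘ suc)
  binomial-suc n x = begin
    1 × x 0 ∙ ∑[ i ≤ n ] ((suc n C suc (toℕ i)) × x (suc (toℕ i)))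
      ≈⟨ ∙-congˡ (sum-cong-≋ {suc n} λ i → trans
           (×-congˡ (≡.sym (nCk+nC[k+1]≡[n+1]C[k+1] n (toℕ i))))
           (×-homo-+ (x (suc (toℕ i))) (n C toℕ i) (n C suc (toℕ i)))) ⟩
    1 × x 0 ∙ ∑[ i ≤ n ] (u i ∙ v i)
      ≈⟨ ∙-congˡ (trans (∑-distrib-+ {suc n} u v) (comm _ _)) ⟩
    1 × x 0 ∙ (∑[ i ≤ n ] v i ∙ binomial n (x ∘ suc))
      -- `n C 0` reduces to 1, so `1 × x 0` is the index 0 term of the sum of `w`.
      ≈⟨ assoc _ _ _ ⟨
    ∑[ i ≤ suc n ] w (toℕ i) ∙ binomial n (x ∘ suc)
      ≈⟨ ∙-congʳ (sum-toℕ-last (suc n) w) ⟩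
    binomial n x ∙ (n C suc n) × x (suc n) ∙ binomial n (x ∘ suc)
      ≈⟨ ∙-congʳ (∙-congˡ (×-congˡ (k>n⇒nCk≡0 (ℕ.n<1+n n)))) ⟩
    binomial n x ∙ ε ∙ binomial n (x ∘ suc)
      ≈⟨ ∙-congʳ (identityʳ (binomial n x)) ⟩
    binomial n x ∙ binomial n (x ∘ suc) ∎
    where
    u v : Fin (suc n) → Carrier
    u i = (n C toℕ i) × x (suc (toℕ i))
    v i = (n C suc (toℕ i)) × x (suc (toℕ i))
    w : ℕ → Carrier
    w i = (n C i) × x i

  module _ (T : ℕ → ℕ → Carrier) where

    row : (i j a : ℕ) → Carrier
    row i j a = binomial a (λ c → T i (j ℕ.+ c))

    row-suc : ∀ i j a → row i j (suc a) ≈ row i j a ∙ row i (suc j) a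
    row-suc i j a = trans (binomial-suc a (λ c → T i (j ℕ.+ c)))
      (∙-congˡ (binomial-cong a λ c _ → reflexive (cong (T i) (ℕ.+-suc j c))))

    -- Total `T` and truncated `∸` let the recurrence below hold without bounds; for `k ≤ i` each
    -- row index `i ∸ (k ∸ a)` is a genuine difference.
    iterated : (i j k : ℕ) → Carrier
    iterated i j k = binomial k (λ a → row (i ∸ (k ∸ a)) j a)

    iterated-zero : ∀ i j → iterated i j 0 ≈ T i j
    iterated-zero i j = begin
      1 × (1 × T i (j ℕ.+ 0) ∙ ε) ∙ ε  ≈⟨ trans (identityʳ _) (×-homo-1 _) ⟩
      1 × T i (j ℕ.+ 0) ∙ ε             ≈⟨ trans (identityʳ _) (×-homo-1 _) ⟩
      T i (j ℕ.+ 0)                      ≡⟨ cong (T i) (+-identityʳ j) ⟩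
      T i j                              ∎

    -- `binomial-suc` on the outer transform gives two halves. In the first, `a ≤ k` turns
    -- `suc k ∸ a` into `suc (k ∸ a)`, the successors cancel, and row `i` appears. In the second,
    -- the inner length is `suc a`, and `row-suc` splits it into the offsets `j` and `suc j`.
    iterated-suc : ∀ i j k →
      iterated (suc i) j (suc k) ≈ iterated i j k ∙ iterated (suc i) j k ∙ iterated (suc i) (suc j) k
    iterated-suc i j k = begin
      iterated (suc i) j (suc k)
        ≈⟨ binomial-suc k (λ a → row (suc i ∸ (suc k ∸ a)) j a) ⟩
      binomial k (λ a → row (suc i ∸ (suc k ∸ a)) j a) ∙ binomial k (λ a → row (r a) j (suc a))
        ≈⟨ ∙-cong
             (binomial-cong k λ a a≤k → reflexive (cong (λ m → row (suc i ∸ m) j a) (ℕ.+-∸-assoc 1 a≤k)))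
             (trans (binomial-cong k λ a _ → row-suc (r a) j a)
                    (binomial-∙ k (λ a → row (r a) j a) (λ a → row (r a) (suc j) a))) ⟩
      iterated i j k ∙ (iterated (suc i) j k ∙ iterated (suc i) (suc j) k)
        ≈⟨ assoc _ _ _ ⟨
      iterated i j k ∙ iterated (suc i) j k ∙ iterated (suc i) (suc j) k ∎
      where
      r : ℕ → ℕ
      r a = suc i ∸ (k ∸ a)

    binomial-term : ∀ n (i : Fin (suc n)) → Fin (suc (toℕ i)) → Carrier
    binomial-term n i j = ((n C toℕ i) ℕ.* (toℕ i C toℕ j)) × T (toℕ i) (toℕ j)

    -- On the diagonal the outer index is itself the row index, since `n ∸ (n ∸ i)` is `i`; nested
    -- multiples then merge into a product of coefficients.
    iterated-diagonal : ∀ n → iterated n 0 n ≈ triangle-sum n (binomial-term n)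
    iterated-diagonal n = sum-cong-≋ {suc n} λ i → begin
      (n C toℕ i) × row (n ∸ (n ∸ toℕ i)) 0 (toℕ i)
        ≡⟨ cong (λ m → (n C toℕ i) × row m 0 (toℕ i)) (ℕ.m∸[m∸n]≡n (toℕ≤pred[n] i)) ⟩
      (n C toℕ i) × row (toℕ i) 0 (toℕ i)
        ≈⟨ ×-distrib-sum (n C toℕ i) {suc (toℕ i)} (λ j → (toℕ i C toℕ j) × T (toℕ i) (toℕ j)) ⟩
      ∑[ j ≤ toℕ i ] ((n C toℕ i) × ((toℕ i C toℕ j) × T (toℕ i) (toℕ j)))
        ≈⟨ sum-cong-≋ {suc (toℕ i)} (λ j → ×-assocˡ (T (toℕ i) (toℕ j)) (n C toℕ i) (toℕ i C toℕ j)) ⟩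
      sum (binomial-term n i) ∎

nCk*[k!*[n∸k]!]≡n! : ∀ {n k} → k ≤ n → (n C k) ℕ.* (k ! ℕ.* (n ∸ k) !) ≡ n !
nCk*[k!*[n∸k]!]≡n! {n} {k} k≤n = ≡.trans
  (cong (ℕ._* (k ! ℕ.* (n ∸ k) !)) (nCk≡n!/k![n-k]! k≤n))
  (ℕ.m/n*n≡m {{k ℕ.!* (n ∸ k) !≢0}} (k![n∸k]!∣n! k≤n))

-- Both sides times the nonzero denominator `d` give `n !`: on the right, `n !` is expanded through
-- `n C i`, and then its factor `i !` through `i C j`.
trinomial≡nCi*iCj : ∀ {n i j} .(e : j ℕ.+ (n ∸ i) ℕ.+ (i ∸ j) ≡ n) → i ≤ n → j ≤ i →
  trinomial n j (n ∸ i) (i ∸ j) e ≡ (n C i) ℕ.* (i C j)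
trinomial≡nCi*iCj {n} {i} {j} e i≤n j≤i = ℕ.*-cancelʳ-≡ _ _ d {{d≢0}} (begin
  trinomial n j (n ∸ i) (i ∸ j) e ℕ.* d
    -- `e` is irrelevant; decidable equality on ℕ recovers the relevant proof that `trinomial-exact`
    -- takes.
    ≡⟨ trinomial-exact n j (n ∸ i) (i ∸ j) (recompute (_ ℕ.≟ n) e) ⟩
  n !
    ≡⟨ nCk*[k!*[n∸k]!]≡n! i≤n ⟨
  (n C i) ℕ.* (i ! ℕ.* (n ∸ i) !)
    ≡⟨ cong (λ m → (n C i) ℕ.* (m ℕ.* (n ∸ i) !)) (nCk*[k!*[n∸k]!]≡n! j≤i) ⟨
  (n C i) ℕ.* ((i C j) ℕ.* (j ! ℕ.* (i ∸ j) !) ℕ.* (n ∸ i) !)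
    ≡⟨ solve 5 (λ x y p q r → x :* (y :* (p :* r) :* q) := x :* y :* (p :* q :* r)) ≡.refl
         (n C i) (i C j) (j !) ((n ∸ i) !) ((i ∸ j) !) ⟩
  (n C i) ℕ.* (i C j) ℕ.* d ∎)
  where
  open ≡.≡-Reasoning
  open +-*-Solver
  d = j ! ℕ.* (n ∸ i) ! ℕ.* (i ∸ j) !
  d≢0 : ℕ.NonZero d
  d≢0 = ℕ.m*n≢0 _ _ {{j ℕ.!* (n ∸ i) !≢0}} {{(i ∸ j) ℕ.!≢0}}

open BinomialTransform (CommutativeRing.+-commutativeMonoid ℝ-commutativeRing)
open import Algebra.Properties.CommutativeMonoid.Mult (CommutativeRing.+-commutativeMonoid ℝ-commutativeRing) using (_×_)

n/1 : ∀ n → + n ℚ./ 1 ≡ mkℚ (+ n) 0 (Coprime.sym (1-coprimeTo n))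
n/1 n = ℚ.normalize-coprime (Coprime.sym (1-coprimeTo n))

-- With `n / 1` in the normal form of `n/1`, rational addition computes to a fraction over 1 with
-- numerator `1 + n * 1`.
[1+n]/1≡1+n/1 : ∀ n → + suc n ℚ./ 1 ≡ 1ℚ ℚ.+ (+ n ℚ./ 1)
[1+n]/1≡1+n/1 n = ≡.trans
  (cong (ℚ._/ 1) (≡.sym (cong (ℤ._+_ (+ 1)) (ℤ.*-identityʳ (+ n)))))
  (cong (1ℚ ℚ.+_) (≡.sym (n/1 n)))

-- Bridge between the products with `fromℕ` in `b` and the monoid action `×`, as an equality of
-- rational entries, which is stronger than `_≃_`.
seq-× : ∀ m x k → (+ m ℚ./ 1) ℚ.* seq x k ≡ seq (m × x) k
seq-× zero    x k = ℚ.*-zeroˡ (seq x k)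
seq-× (suc m) x k = begin
  (+ suc m ℚ./ 1) ℚ.* seq x k                      ≡⟨ cong (ℚ._* seq x k) ([1+n]/1≡1+n/1 m) ⟩
  (1ℚ ℚ.+ (+ m ℚ./ 1)) ℚ.* seq x k                 ≡⟨ ℚ.*-distribʳ-+ (seq x k) 1ℚ (+ m ℚ./ 1) ⟩
  1ℚ ℚ.* seq x k ℚ.+ (+ m ℚ./ 1) ℚ.* seq x k       ≡⟨ cong₂ ℚ._+_ (ℚ.*-identityˡ (seq x k)) (seq-× m x k) ⟩
  seq x k ℚ.+ seq (m × x) k                        ∎
  where open ≡.≡-Reasoning

-- The junk value 0 outside the triangle never reaches the domain of h.
extend : Triangle → ℕ → ℕ → ℝ
extend t i j with j ℕ.≤? i
... | yes j≤i = t i j j≤i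
... | no  _   = 0ℝ

extend-≤ : ∀ t i j .(j≤i : j ≤ i) → extend t i j ≡ t i j j≤i
extend-≤ t i j j≤i with j ℕ.≤? i
... | yes _   = ≡.refl
... | no  j≰i = contradiction-irr j≤i j≰i

h≃iterated : ∀ t i j k .(le : k ℕ.+ j ≤ i) → h t i j k le ≃ iterated (extend t) i j k
h≃iterated t i j zero le =
  ≡.subst (_≃ iterated (extend t) i j 0) (extend-≤ t i j le)
    (≃-sym {iterated (extend t) i j 0} {extend t i j} (iterated-zero (extend t) i j))
h≃iterated t (suc i) j (suc k) le =
  -- The implicit reals are supplied because `_≃_` unfolds to a statement about sequences alone,
  -- which does not determine the Cauchy proofs.
  ≃-trans {h t (suc i) j (suc k) le} {A + B + D} {iterated (extend t) (suc i) j (suc k)}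
    (+-cong {h₁ + h₂} {A + B} {h₃} {D}
      (+-cong {h₁} {A} {h₂} {B} (h≃iterated t i j k _) (h≃iterated t (suc i) j k _))
      (h≃iterated t (suc i) (suc j) k _))
    (≃-sym {iterated (extend t) (suc i) j (suc k)} {A + B + D} (iterated-suc (extend t) i j k))
  where
  A = iterated (extend t) i j k
  B = iterated (extend t) (suc i) j k
  D = iterated (extend t) (suc i) (suc j) k
  h₁ = h t i j k (ℕ.s≤s⁻¹ le)
  h₂ = h t (suc i) j k (ℕ.<⇒≤ le)
  h₃ = h t (suc i) (suc j) k (≡.subst (_≤ suc i) (≡.sym (ℕ.+-suc k j)) le)

j+[n∸i]+[i∸j]≡n : ∀ {n i j} → i ≤ n → j ≤ i → j ℕ.+ (n ∸ i) ℕ.+ (i ∸ j) ≡ n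
j+[n∸i]+[i∸j]≡n {n} {i} {j} i≤n j≤i = begin
  j ℕ.+ (n ∸ i) ℕ.+ (i ∸ j)  ≡⟨ solve 3 (λ x y z → x :+ y :+ z := x :+ z :+ y) ≡.refl j (n ∸ i) (i ∸ j) ⟩
  j ℕ.+ (i ∸ j) ℕ.+ (n ∸ i)  ≡⟨ cong (ℕ._+ (n ∸ i)) (ℕ.m+[n∸m]≡n j≤i) ⟩
  i ℕ.+ (n ∸ i)              ≡⟨ ℕ.m+[n∸m]≡n i≤n ⟩
  n                          ∎
  where
  open ≡.≡-Reasoning
  open +-*-Solver

-- The index equation is an irrelevant argument of `trinomial`, so the proof used here and the one
-- inside `b` yield the same summand.
b-term : Triangle → ∀ n (i : Fin (suc n)) → Fin (suc (toℕ i)) → ℝ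
b-term t n i′ j′ =
  let i = toℕ i′
      j = toℕ j′
  in fromℕ (trinomial n j (n ∸ i) (i ∸ j) (j+[n∸i]+[i∸j]≡n (toℕ≤pred[n] i′) (toℕ≤pred[n] j′)))
     * t i j (toℕ≤pred[n] j′)

seq-binomial-term : ∀ t n i j k → seq (binomial-term (extend t) n i j) k ≡ seq (b-term t n i j) k
seq-binomial-term t n i′ j′ k = begin
  seq (((n C i) ℕ.* (i C j)) × extend t i j) k
    ≡⟨ cong₂ (λ m x → seq (m × x) k) (≡.sym (trinomial≡nCi*iCj e (toℕ≤pred[n] i′) j≤i)) (extend-≤ t i j j≤i) ⟩
  seq (trinomial n j (n ∸ i) (i ∸ j) e × t i j j≤i) k
    ≡⟨ seq-× (trinomial n j (n ∸ i) (i ∸ j) e) (t i j j≤i) k ⟨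
  seq (b-term t n i′ j′) k ∎
  where
  open ≡.≡-Reasoning
  i = toℕ i′
  j = toℕ j′
  j≤i = toℕ≤pred[n] j′
  e = j+[n∸i]+[i∸j]≡n (toℕ≤pred[n] i′) j≤i

-- An entry of a real sum computes to the rational sum of the entries, so propositional equality
-- passes through by congruence.
seq-sum-cong : ∀ {n} (f : Fin n → ℝ) {g : Fin n → ℝ} k →
  (∀ i → seq (f i) k ≡ seq (g i) k) → seq (sum f) k ≡ seq (sum g) k
seq-sum-cong {zero}  f k f≡g = ≡.refl
seq-sum-cong {suc n} f k f≡g =
  cong₂ ℚ._+_ (f≡g Fin.zero) (seq-sum-cong (f ∘ Fin.suc) k (f≡g ∘ Fin.suc))

seq-sum-suc : ∀ {n} (f : Fin (suc n) → ℝ) {q} {g : Fin n → ℝ} k → seq (f Fin.zero) k ≡ q →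
  (∀ i → seq (f (Fin.suc i)) k ≡ seq (g i) k) → seq (sum f) k ≡ q ℚ.+ seq (sum g) k
seq-sum-suc f k f₀≡q f≡g = cong₂ ℚ._+_ f₀≡q (seq-sum-cong (f ∘ Fin.suc) k f≡g)

-- The leading summands are split off until the number of remaining ones is
-- neutral, so that the remaining summands of b are found by unification: stating
-- them would force a definitional comparison of Cauchy proofs, which blows up.
seq-triangle-sum : ∀ t n k (x : ∀ i → Fin (suc (toℕ i)) → ℝ) →
  (∀ i j → seq (x i j) k ≡ seq (b-term t n i j) k) → seq (triangle-sum n x) k ≡ seq (b t n) k
seq-triangle-sum t n k x x≡b =
  seq-sum-suc (λ i → sum (x i)) {seq (b-term t n 0F 0F + 0ℝ) k} k
    (cong (ℚ._+ seq 0ℝ k) (x≡b 0F 0F))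
    λ i → cong₂ ℚ._+_ {y = seq (b-term t n (Fin.suc i) 0F) k} (x≡b (Fin.suc i) 0F)
      (seq-sum-suc (x (Fin.suc i) ∘ Fin.suc) {seq (b-term t n (Fin.suc i) 1F) k} k
        (x≡b (Fin.suc i) 1F)
        λ j → x≡b (Fin.suc i) (Fin.suc (Fin.suc j)))

iterated≃b : ∀ t n → iterated (extend t) n 0 n ≃ b t n
iterated≃b t n = ≃-trans {iterated (extend t) n 0 n} {S} {b t n}
  (iterated-diagonal (extend t) n)
  (≃-pointwise S (b t n) λ k →
    seq-triangle-sum t n k (binomial-term (extend t) n) λ i j → seq-binomial-term t n i j k)
  where
  S = triangle-sum n (binomial-term (extend t) n)

theorem2 : (t : Triangle) (n : ℕ) → h t n 0 n (≤-reflexive (+-identityʳ n)) ≃ b t n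
theorem2 t n = ≃-trans {h t n 0 n _} {iterated (extend t) n 0 n} {b t n}
  (h≃iterated t n 0 n _) (iterated≃b t n)
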